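{- Let $\varphi$ be an RTLola$^f$ specification (RTLola extended with future offsets) that is well-formed, i.e. its dependency graph $G_\varphi$ contains no cycle with accumulated edge weight zero, no cycle containing both a $\mathit{Filter}$-edge and an $\mathit{Offset}$-edge, and no cycle containing both an $\mathit{Offset}$-edge with positive offset and an edge of kind $\mathit{Aggr}$ or $\mathit{Hold}$. Then $\varphi$ is well-defined: for every input stream assignment $I:\mathrm{Time}\to(\mathtt{ID}^\uparrow\to\mathbb{V}_\bot)$ and every strictly increasing time map $T:\mathrm{Time}\to\mathbb{R}^+$ there exists exactly one evaluation model $\omega\in[\![\varphi]\!]$ such that for all $t\in\mathrm{Time}$, $\omega(t)=T(t)$ and $\omega(\mathit{sid})(t)=I(t)(\mathit{sid})$ for all $\mathit{sid}\in\mathtt{ID}^\uparrow$.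
   Context: **Time and values.** $\mathrm{Time}=\{n\in\mathbb{N}\mid n\le T_{\max}\}$; $\mathbb{V}$ is a domain of values and $\mathbb{V}_\bot=\mathbb{V}\cup\{\bot\}$, where $\bot$ means "no value". **Specifications.** A specification $\varphi$ has finite disjoint sets $\mathtt{ID}^\uparrow$ of input streams and $\mathtt{ID}^\downarrow$ of output streams. Each output stream $s$ has (i) a pacing type, either event-based (a condition on which input streams receive a value at the current timestep) or periodic (a fixed period; satisfied at the timesteps whose real timestamp is a multiple of the period), (ii) a Boolean when-expression (possibly just $\mathit{true}$), and (iii) a with-expression. Expressions are built from constants, the current timestamp, pure total functions on values, and stream accesses to a stream $x$: synchronous access $\mathrm{sync}(x)$; discrete offset $x.\mathit{offset}(\mathit{by}:o)$ with $o\in\mathbb{Z}$; $x.\mathit{hold}()$; sliding-window aggregation of $x$ with an aggregation function $f\in\mathcal{F}$ over a real-time duration $r$. Offset, hold and aggregation accesses may yield $\bot$ and are wrapped in a default expression that replaces $\bot$ by a given value. Specifications are well-typed: value types match, and pacing types (including when-conditions) guarantee that whenever a stream $s$ is evaluated at $t$ and accesses $x$ by a synchronous or offset access, $x$ also has a value at exactly the time $t$. Hold and aggregation accesses are asynchronous and carry no such requirement. **Evaluation models.** An evaluation model $\omega$ consists of a map assigning to each stream $s\in\mathtt{ID}^\uparrow\uplus\mathtt{ID}^\downarrow$ a function $\omega(s):\mathrm{Time}\to\mathbb{V}_\bot$ and a time map $\mathrm{Time}\to\mathbb{R}^+$, written $t\mapsto\omega(t)$. **Expression semantics at time $t$ in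 $\omega$.** $\mathrm{sync}(x)$ yields $\omega(x)(t)$. For $o>0$, let $\mathit{sfx}$ be the sequence (indexed from $0$) of all non-$\bot$ values of $x$ at times $\ge t$ in chronological order; $x.\mathit{offset}(\mathit{by}:o)$ yields $\mathit{sfx}[o]$ if $|\mathit{sfx}|>o$ and $\bot$ otherwise. For $o<0$ it is defined analogously with the sequence of non-$\bot$ values at times $\le t$ read backwards from $t$ (index $|o|$); for $o=0$ it equals $\mathrm{sync}(x)$. $x.\mathit{hold}()$ yields the value of $x$ at the latest $t'\le t$ with $\omega(x)(t')\ne\bot$, or $\bot$ if there is none. An aggregation applies $f$ to the values of $x$ at the times $t'\le t$ with $\omega(x)(t')\neq\bot$ and real timestamp in the window $(\omega(t)-r,\omega(t)]$. The stream equation $\varphi(s)$ evaluates at $t$ to the value of the with-expression if the pacing condition is satisfied at $t$ and the when-expression evaluates to true, and to $\bot$ otherwise. $\varphi(s)\Downarrow_\omega^t v$ denotes that it evaluates to $v$. **Semantics.** $[\![\varphi]\!]$ is the set of evaluation models $\omega$ such that $\varphi(s)\Downarrow_\omega^t\omega(s)(t)$ for all $s\in\mathtt{ID}^\downarrow$, $t\in\mathrm{Time}$, and $\omega(t)<\omega(t+1)$ whenever $t,t+1\in\mathrm{Time}$. **Dependency graph.** $G_\varphi=\langle V,E\rangle$ is the directed multigraph with $V=\mathtt{ID}^\uparrow\uplus\mathtt{ID}^\downarrow$ and labelled edges $(s,(b,k),s')$, one for each access to $s'$ of kind $k$ in the expressions of $s$, where $b=\mathit{Filter}$ if the access occurs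 in the when-expression and $b=\mathit{Eval}$ if it occurs in the with-expression, and $k$ is $\mathit{Sync}$, $\mathit{Hold}$, $(\mathit{Offset},o)$ with $o\in\mathbb{Z}$, or $(\mathit{Aggr},f,r)$. The weight of an edge is $o$ for kind $(\mathit{Offset},o)$ and $0$ for all other kinds; the accumulated weight of a cycle is the sum of its edge weights. "Cycle" means closed walk of length at least one (vertices and edges may repeat). -}

module Defs where

open import Algebra.Bundles.Raw using (RawMonoid)
import Algebra.Definitions.RawMonoid as RawMonoidDefs
open import Algebra.Structures using (IsCommutativeRing)
open import Data.Bool.Base using (Bool; true; T)
open import Data.Fin.Base as Fin using (Fin; inject₁; suc)
import Data.Fin.Properties as Fin
open import Data.Fin.Subset using (Subset)
open import Data.Integer.Base as ℤ using (ℤ; -[1+_]; 0ℤ; +0; +[1+_])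
open import Data.List.Base as List using (List; []; _∷_; _++_; allFin; mapMaybe; filter; reverse; drop; head)
open import Data.List.Membership.Propositional using (_∈_)
open import Data.List.Relation.Unary.All using (All; []; _∷_)
open import Data.Maybe.Base as Maybe using (Maybe; just; nothing; is-just)
open import Data.Maybe using (Is-just)
open import Data.Nat.Base as ℕ using (ℕ)
open import Data.Product using (_×_; _,_; ∃; ∃!)
open import Data.Sum.Base using (_⊎_; inj₁; inj₂)
open import Data.Vec.Base using (tabulate)
open import Relation.Binary.Construct.Closure.Transitive using (TransClosure; [_]; _∷_)
import Relation.Binary.Construct.StrictToNonStrict as StrictToNonStrict
open import Relation.Binary.Definitions using (Decidable)
open import Relation.Binary.PropositionalEquality using (_≡_; _≢_)
open import Relation.Binary.Structures using (IsStrictTotalOrder)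
open import Relation.Nullary using (¬_; Dec; _×-dec_)

-- Real time.  The classical field ℝ is an instance of this record, and the
-- theory is developed for every instance.  Decidability of the order, which
-- evaluating window boundaries needs, is part of `IsStrictTotalOrder`.
record ArchimedeanOrderedField : Set₁ where
  infix  4 _<_
  infixl 6 _+_
  infixl 7 _*_
  infix  8 -_
  field
    ℝ       : Set
    _<_     : ℝ → ℝ → Set
    _+_ _*_ : ℝ → ℝ → ℝ
    -_      : ℝ → ℝ
    0# 1#   : ℝ

    isCommutativeRing  : IsCommutativeRing _≡_ _+_ _*_ -_ 0# 1#
    0≢1                : 0# ≢ 1#
    inverse            : ∀ x → x ≢ 0# → ∃ λ y → x * y ≡ 1#

    isStrictTotalOrder : IsStrictTotalOrder _≡_ _<_
    +-monoˡ-<          : ∀ z {x y} → x < y → x + z < y + z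
    *-pos              : ∀ {x y} → 0# < x → 0# < y → 0# < x * y

  +-rawMonoid : RawMonoid _ _
  +-rawMonoid = record { Carrier = ℝ ; _≈_ = _≡_ ; _∙_ = _+_ ; ε = 0# }

  open RawMonoidDefs +-rawMonoid public
    using () renaming (_×_ to _·_)

  field
    archimedean        : ∀ x y → 0# < x → ∃ λ n → y < n · x

  open IsStrictTotalOrder isStrictTotalOrder public using (compare; _<?_)
  open StrictToNonStrict _≡_ _<_ public using (_≤_)

  infix 4 _≤?_
  _≤?_ : Decidable _≤_
  _≤?_ = StrictToNonStrict.decidable′ _≡_ _<_ compare

  infixl 6 _-_
  _-_ : ℝ → ℝ → ℝ
  x - y = x + (- y)

  -- 0 is included, so that a timestamp may be 0.  The irrelevant field makes
  -- equality of elements amount to equality of their values.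
  record ℝ⁺ : Set where
    constructor _,⁺_
    field
      value   : ℝ
      .nonneg : 0# ≤ value

  open ℝ⁺ public using (value)

-- The domain 𝕍 is presented as a family of sets indexed by value types, so
-- that "value types match" holds by construction.
data Ty (Base : Set) : Set where
  bool time : Ty Base
  base      : Base → Ty Base

module _ (𝔽 : ArchimedeanOrderedField) where
  open ArchimedeanOrderedField 𝔽 using (ℝ⁺)

  Interpret : {Base : Set} → (Base → Set) → Ty Base → Set
  Interpret ⟦_⟧ᵇ bool     = Bool
  Interpret ⟦_⟧ᵇ time     = ℝ⁺
  Interpret ⟦_⟧ᵇ (base b) = ⟦ b ⟧ᵇ

  record ValueDomain : Set₁ where
    field
      Base : Set
      ⟦_⟧ᵇ : Base → Set

    Type : Set
    Type = Ty Base

    ⟦_⟧ᵗ : Type → Set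
    ⟦_⟧ᵗ = Interpret ⟦_⟧ᵇ

    field
      𝓕         : Type → Type → Set
      aggregate : ∀ {σ τ} → 𝓕 σ τ → List ⟦ σ ⟧ᵗ → Maybe ⟦ τ ⟧ᵗ

module RTLola (𝔽 : ArchimedeanOrderedField) (𝓥 : ValueDomain 𝔽) (Tmax : ℕ) where

  open ArchimedeanOrderedField 𝔽
  open ValueDomain 𝓥

  Time : Set
  Time = Fin (ℕ.suc Tmax)

  record Signature : Set where
    field
      #inputs #outputs : ℕ

    ID↑ : Set
    ID↑ = Fin #inputs

    ID↓ : Set
    ID↓ = Fin #outputs

    Stream : Set
    Stream = ID↑ ⊎ ID↓

    field
      typeOf : Stream → Type

  module _ (𝕊 : Signature) where
    open Signature 𝕊

    -- The accesses that may yield ⊥ even for a well-typed specification.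
    data Access : Type → Set where
      offset : (x : Stream) (by : ℤ) → Access (typeOf x)
      hold   : (x : Stream) → Access (typeOf x)
      aggr   : ∀ {τ} (x : Stream) (f : 𝓕 (typeOf x) τ) (r : ℝ⁺) → Access τ

    data Expr : Type → Set where
      const   : ∀ {τ} → ⟦ τ ⟧ᵗ → Expr τ
      now     : Expr time
      fun     : ∀ {σs τ} → (All ⟦_⟧ᵗ σs → ⟦ τ ⟧ᵗ) → All Expr σs → Expr τ
      sync    : (x : Stream) → Expr (typeOf x)
      default : ∀ {τ} → Access τ → Expr τ → Expr τ

    data Pacing : Set where
      -- The subset is that of the inputs receiving a value now.
      event    : (Subset #inputs → Bool) → Pacing
      periodic : (p : ℝ⁺) → 0# < value p → Pacing

    record EvaluationModel : Set where
      field
        stream    : (s : Stream) → Time → Maybe ⟦ typeOf s ⟧ᵗ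
        timestamp : Time → ℝ⁺

  record Specification : Set where
    field
      signature : Signature
    open Signature signature public
    field
      pacing   : ID↓ → Pacing signature
      whenExpr : ID↓ → Expr signature bool
      withExpr : (s : ID↓) → Expr signature (typeOf (inj₂ s))

  module Semantics {𝕊 : Signature} (ω : EvaluationModel 𝕊) where
    open Signature 𝕊
    open EvaluationModel ω

    valuesAt : (x : Stream) → List Time → List ⟦ typeOf x ⟧ᵗ
    valuesAt x = mapMaybe (stream x)

    suffix : (x : Stream) → Time → List ⟦ typeOf x ⟧ᵗ
    suffix x t = valuesAt x (filter (λ t′ → t Fin.≤? t′) (allFin _))

    -- Latest value first.
    prefix : (x : Stream) → Time → List ⟦ typeOf x ⟧ᵗ
    prefix x t = valuesAt x (reverse (filter (λ t′ → t′ Fin.≤? t) (allFin _)))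

    InWindow : ℝ⁺ → Time → Time → Set
    InWindow r t t′ =
      t′ Fin.≤ t ×
      (value (timestamp t) - value r < value (timestamp t′) ×
       value (timestamp t′) ≤ value (timestamp t))

    inWindow? : ∀ r t t′ → Dec (InWindow r t t′)
    inWindow? r t t′ =
      t′ Fin.≤? t ×-dec
      (value (timestamp t) - value r <? value (timestamp t′) ×-dec
       value (timestamp t′) ≤? value (timestamp t))

    window : (x : Stream) → ℝ⁺ → Time → List ⟦ typeOf x ⟧ᵗ
    window x r t = valuesAt x (filter (inWindow? r t) (allFin _))

    access : ∀ {τ} → Access 𝕊 τ → Time → Maybe ⟦ τ ⟧ᵗ
    access (offset x +0)       t = stream x t
    access (offset x +[1+ n ]) t = head (drop (ℕ.suc n) (suffix x t))
    access (offset x -[1+ n ]) t = head (drop (ℕ.suc n) (prefix x t))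
    access (hold x)            t = head (prefix x t)
    access (aggr x f r)        t = aggregate f (window x r t)

    -- `nothing` means that the expression has no value because a synchronous
    -- access in it failed.
    mutual
      eval : ∀ {τ} → Expr 𝕊 τ → Time → Maybe ⟦ τ ⟧ᵗ
      eval (const v)     t = just v
      eval now           t = just (timestamp t)
      eval (fun f es)    t = Maybe.map f (evalAll es t)
      eval (sync x)      t = stream x t
      eval (default a e) t with access a t
      ... | just v  = just v
      ... | nothing = eval e t

      evalAll : ∀ {σs} → All (Expr 𝕊) σs → Time → Maybe (All ⟦_⟧ᵗ σs)
      evalAll []       t = just []
      evalAll (e ∷ es) t = Maybe.zipWith _∷_ (eval e t) (evalAll es t)

    received : Time → Subset #inputs
    received t = tabulate λ i → is-just (stream (inj₁ i) t)

    PacingSatisfied : Pacing 𝕊 → Time → Set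
    PacingSatisfied (event c)      t = T (c (received t))
    PacingSatisfied (periodic p _) t = ∃ λ k → value (timestamp t) ≡ k · value p

  module _ (φ : Specification) where
    open Specification φ

    Model : Set
    Model = EvaluationModel signature

    open EvaluationModel

    -- The condition under which the with-expression of s is evaluated.
    Active : Model → ID↓ → Time → Set
    Active ω s t = PacingSatisfied (pacing s) t × eval (whenExpr s) t ≡ just true
      where open Semantics ω

    data _⇓[_,_]_ (s : ID↓) (ω : Model) (t : Time) :
                  Maybe ⟦ typeOf (inj₂ s) ⟧ᵗ → Set where
      emit : ∀ {v} → Active ω s t → Semantics.eval ω (withExpr s) t ≡ just v →
             s ⇓[ ω , t ] just v
      skip : ¬ Active ω s t → s ⇓[ ω , t ] nothing

    IncreasingTime : Model → Set
    IncreasingTime ω = ∀ (t : Fin Tmax) →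
      value (timestamp ω (inject₁ t)) < value (timestamp ω (suc t))

    record ⟦_⟧∋_ (ω : Model) : Set where
      field
        equations  : ∀ s t → s ⇓[ ω , t ] stream ω (inj₂ s) t
        increasing : IncreasingTime ω

    data Origin : Set where
      Filter Eval : Origin

    data Kind : Set where
      Sync Hold : Kind
      Offset    : ℤ → Kind
      Aggr      : ∀ {σ τ} → 𝓕 σ τ → ℝ⁺ → Kind

    Label : Set
    Label = Origin × Kind

    accessTarget : ∀ {τ} → Access signature τ → Kind × Stream
    accessTarget (offset x o) = Offset o , x
    accessTarget (hold x)     = Hold , x
    accessTarget (aggr x f r) = Aggr f r , x

    mutual
      accesses : ∀ {τ} → Expr signature τ → List (Kind × Stream)
      accesses (const _)     = []
      accesses now           = []
      accesses (fun _ es)    = accessesAll es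
      accesses (sync x)      = (Sync , x) ∷ []
      accesses (default a e) = accessTarget a ∷ accesses e

      accessesAll : ∀ {σs} → All (Expr signature) σs → List (Kind × Stream)
      accessesAll []       = []
      accessesAll (e ∷ es) = accesses e ++ accessesAll es

    outgoing : Stream → List (Label × Stream)
    outgoing (inj₁ _) = []
    outgoing (inj₂ s) =
      List.map (λ (k , x) → (Filter , k) , x) (accesses (whenExpr s)) ++
      List.map (λ (k , x) → (Eval   , k) , x) (accesses (withExpr s))

    -- Parallel edges with equal labels are told apart by their membership proofs.
    Edge : Stream → Stream → Set
    Edge s s′ = ∃ λ (ℓ : Label) → (ℓ , s′) ∈ outgoing s

    Cycle : Stream → Set
    Cycle s = TransClosure Edge s s

    kindWeight : Kind → ℤ
    kindWeight (Offset o) = o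
    kindWeight _          = 0ℤ

    weight : ∀ {s s′} → TransClosure Edge s s′ → ℤ
    weight [ (_ , k) , _ ]     = kindWeight k
    weight (((_ , k) , _) ∷ w) = kindWeight k ℤ.+ weight w

    Contains : (Label → Set) → ∀ {s s′} → TransClosure Edge s s′ → Set
    Contains P [ ℓ , _ ]     = P ℓ
    Contains P ((ℓ , _) ∷ w) = P ℓ ⊎ Contains P w

    data IsFilter : Label → Set where
      isFilter : ∀ {k} → IsFilter (Filter , k)

    data IsOffset : Label → Set where
      isOffset : ∀ {b o} → IsOffset (b , Offset o)

    data IsFutureOffset : Label → Set where
      isFutureOffset : ∀ {b o} → 0ℤ ℤ.< o → IsFutureOffset (b , Offset o)

    data IsAggrOrHold : Label → Set where
      isAggr : ∀ {b σ τ} {f : 𝓕 σ τ} {r} → IsAggrOrHold (b , Aggr f r)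
      isHold : ∀ {b} → IsAggrOrHold (b , Hold)

    data IsSyncOrOffset : Label → Set where
      isSync   : ∀ {b} → IsSyncOrOffset (b , Sync)
      isOffset : ∀ {b o} → IsSyncOrOffset (b , Offset o)

    record WellFormed : Set where
      field
        noZeroCycle         : ∀ {s} (c : Cycle s) → weight c ≢ 0ℤ
        noFilterOffsetCycle : ∀ {s} (c : Cycle s) →
          ¬ (Contains IsFilter c × Contains IsOffset c)
        noFutureAsyncCycle  : ∀ {s} (c : Cycle s) →
          ¬ (Contains IsFutureOffset c × Contains IsAggrOrHold c)

    Available : Model → Stream → Time → Set
    Available ω (inj₁ i) t = Is-just (stream ω (inj₁ i) t)
    Available ω (inj₂ s) t = Active ω s t

    -- Pacing types and when-conditions alone guarantee that synchronously
    -- accessed streams are available.  Hence the quantification is over all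
    -- models, including those that do not solve the stream equations, and
    -- availability of an output means that its pacing and when-conditions hold.
    WellTyped : Set
    WellTyped = ∀ {s x} ((ℓ , _) : Edge (inj₂ s) x) → IsSyncOrOffset ℓ →
      ∀ ω → IncreasingTime ω → ∀ t → Active ω s t → Available ω x t

    -- Agda lacks function extensionality, so models are compared pointwise.
    record _≈ᵐ_ (ω ω′ : Model) : Set where
      field
        stream-≡    : ∀ s t → stream ω s t ≡ stream ω′ s t
        timestamp-≡ : ∀ t → timestamp ω t ≡ timestamp ω′ t

    WellDefined : Set
    WellDefined =
      (I : Time → (i : ID↑) → Maybe ⟦ typeOf (inj₁ i) ⟧ᵗ) →
      (τ : Time → ℝ⁺) → (∀ {t t′} → t Fin.< t′ → value (τ t) < value (τ t′)) →
      ∃! _≈ᵐ_ λ ω → ⟦_⟧∋_ ω ×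
        (∀ t → timestamp ω t ≡ τ t × (∀ i → stream ω (inj₁ i) t ≡ I t i))

-- Models with the given inputs and timestamps are iterated under the stream
-- equations; the theorem holds once all n-th iterates coincide for some n.
-- No cycle contains a Filter edge, since its other edges would have weight 0
-- too.  Hence one may argue by induction along walks that start with a Filter
-- edge: once everything behind the when-expressions has settled, so has the
-- set of times at which each stream has a value.  Given these sets, a value
-- depends on the values at certain (stream, time) pairs, and a cycle of such
-- dependencies would project to a cycle of weight 0.  Indeed, if the projected
-- cycle contains a Hold or Aggr edge, it contains no future offset, time never
-- increases along it, and so all its offsets are 0.  Otherwise well-typedness
-- makes all its streams available at the same times, and its weight is the
-- difference of the positions of equal times among these.

module Submission where

open import Defs
open import Algebra.Structures using (module IsCommutativeRing)
open import Data.Bool.Base using (true; T)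
import Data.Bool.Properties as Bool
open import Data.Empty using (⊥; ⊥-elim)
open import Data.Fin.Base as Fin using (Fin; zero; suc; inject₁; toℕ; fromℕ<; combine)
import Data.Fin.Properties as Fin
open import Data.Integer.Base as ℤ using (ℤ; 0ℤ; +0; +_; +[1+_]; -[1+_])
import Data.Integer.Properties as ℤ
open import Algebra.Properties.AbelianGroup ℤ.+-0-abelianGroup using (identityʳ-unique)
open import Data.List.Base as List using
  (List; []; _∷_; _++_; length; filter; reverse; drop; head; mapMaybe; allFin)
import Data.List.Properties as List
open import Data.List.Membership.Propositional using (_∈_)
open import Data.List.Membership.Propositional.Properties using
  (∈-∃++; ∈-allFin; ∈-++⁺ˡ; ∈-++⁺ʳ; ∈-map⁺; ∈-filter⁻)
open import Data.List.Relation.Binary.Permutation.Propositional.Properties using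
  (↭-length; ↭-reverse; filter-↭)
open import Data.List.Relation.Unary.All as All using (All; []; _∷_)
import Data.List.Relation.Unary.All.Properties as All
open import Data.List.Relation.Unary.AllPairs using (AllPairs; []; _∷_)
import Data.List.Relation.Unary.AllPairs.Properties as AllPairs
open import Data.List.Relation.Unary.Any using (here; there)
open import Data.List.Relation.Unary.Any.Properties using (reverse⁻)
open import Data.Maybe using (Is-just)
open import Data.Maybe.Base as Maybe using (Maybe; just; nothing; is-just)
import Data.Maybe.Properties as Maybe
open import Data.Maybe.Relation.Unary.Any using (just)
open import Data.Nat.Base as ℕ using (ℕ; zero; suc; z≤n; s≤s)
import Data.Nat.Properties as ℕ
open import Data.Product using (_×_; _,_; ∃; proj₁; proj₂; map₂; uncurry)
open import Data.Sum.Base using (inj₁; inj₂)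
open import Data.Unit using (⊤; tt)
import Data.Vec.Functional as Vector
import Data.Vec.Properties as Vec
open import Function using (id; _∘_)
open import Function.Definitions using (Injective)
open import Level using (0ℓ)
open import Relation.Binary.Construct.Closure.ReflexiveTransitive using (Star; ε; _◅_; _◅◅_)
open import Relation.Binary.Construct.Closure.Transitive as Closure using
  (TransClosure; [_]; _∷_; _∷ʳ_)
open import Relation.Binary.Core using (Rel)
open import Relation.Binary.PropositionalEquality
open import Relation.Binary.Structures using (module IsStrictTotalOrder)
open import Relation.Nullary
open import Relation.Unary using (Decidable; Pred)

-- Induction along acyclic relations

-- The pigeonhole principle bounds the length of R-chains, so the induction is
-- well-founded; the index k, which decreases along R, will bound the number of
-- iterations after which a property holds.
acyclic-induction :
  {A : Set} {n : ℕ} {ι : A → Fin n} → Injective _≡_ _≡_ ι →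
  {R : Rel A 0ℓ} → (∀ {x} → ¬ TransClosure R x x) →
  (P : ℕ → A → Set) →
  (∀ k {x} → (∀ {y} → R x y → P k y) → P (suc k) x) →
  ∀ x → P (suc n) x
acyclic-induction {A} {n} {ι} ι-injective {R} acyclic P step x =
  go (suc n) 0 (ℕ.+-identityʳ _) (λ ()) (λ { {()} }) (λ ())
  where
  -- `chain` holds the elements passed on the way to `x`, latest first. When the budget `k` is used
  -- up, it has `suc n` members, so two of them coincide.
  go : ∀ k m → k ℕ.+ m ≡ suc n → (chain : Fin m → A) →
       (∀ {i j} → i Fin.< j → TransClosure R (chain j) (chain i)) →
       ∀ {x} → (∀ i → TransClosure R (chain i) x) → P k x
  go zero m refl chain descending _ with Fin.pigeonhole ℕ.≤-refl (ι ∘ chain)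
  ... | i , j , i<j , eq =
    ⊥-elim (acyclic (subst (TransClosure R (chain j)) (ι-injective eq) (descending i<j)))
  go (suc k) m eq chain descending {x} reaches = step k λ {y} Rxy →
    go k (suc m) (trans (ℕ.+-suc k m) eq) (x Vector.∷ chain)
      (λ { {zero}  {suc j} _         → reaches j
         ; {suc i} {suc j} (s≤s i<j) → descending i<j })
      (λ { zero → [ Rxy ] ; (suc i) → reaches i ∷ʳ Rxy })

-- Lists of partial values

-- Since `f` and `g` are defined exactly on `P`, they skip the same elements. Both sides therefore
-- read the one element of `P` that is preceded by `k` others, and only there must `f` and `g`
-- agree.
head-drop-mapMaybe-cong :
  {A B : Set} {P : Pred A 0ℓ} (P? : Decidable P) {f g : A → Maybe B} →
  (∀ {u} → P u → Is-just (f u)) → (∀ {u} → ¬ P u → f u ≡ nothing) →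
  (∀ {u} → P u → Is-just (g u)) → (∀ {u} → ¬ P u → g u ≡ nothing) →
  ∀ k xs →
  (∀ us {u vs} → us ++ u ∷ vs ≡ xs → P u → length (filter P? us) ≡ k → f u ≡ g u) →
  head (drop k (mapMaybe f xs)) ≡ head (drop k (mapMaybe g xs))
head-drop-mapMaybe-cong P? fʲ fⁿ gʲ gⁿ zero    []       f≡g = refl
head-drop-mapMaybe-cong P? fʲ fⁿ gʲ gⁿ (suc k) []       f≡g = refl
head-drop-mapMaybe-cong P? {f} {g} fʲ fⁿ gʲ gⁿ k (x ∷ xs) f≡g with P? x
... | no ¬p rewrite fⁿ ¬p | gⁿ ¬p =
  head-drop-mapMaybe-cong P? fʲ fⁿ gʲ gⁿ k xs λ us eq Pu len →
    f≡g (x ∷ us) (cong (x ∷_) eq) Pu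
      (trans (cong length (List.filter-reject P? ¬p)) len)
... | yes p with f x in fx | g x in gx | fʲ p | gʲ p
head-drop-mapMaybe-cong P? fʲ fⁿ gʲ gⁿ zero (x ∷ xs) f≡g
    | yes p | just _ | just _ | _ | _ = trans (sym fx) (trans (f≡g [] refl p refl) gx)
head-drop-mapMaybe-cong P? fʲ fⁿ gʲ gⁿ (suc k) (x ∷ xs) f≡g
    | yes p | just _ | just _ | _ | _ =
  head-drop-mapMaybe-cong P? fʲ fⁿ gʲ gⁿ k xs λ us eq Pu len →
    f≡g (x ∷ us) (cong (x ∷_) eq) Pu
      (trans (cong length (List.filter-accept P? p)) (cong suc len))

mapMaybe-cong-∈ : {A B : Set} {f g : A → Maybe B} (xs : List A) →
                  (∀ {u} → u ∈ xs → f u ≡ g u) → mapMaybe f xs ≡ mapMaybe g xs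
mapMaybe-cong-∈ []       f≡g = refl
mapMaybe-cong-∈ (x ∷ xs) f≡g =
  cong₂ (Maybe.maybe′ _∷_ id) (f≡g (here refl)) (mapMaybe-cong-∈ xs (f≡g ∘ there))

-- Positions of times within a decidable set of times

module Index {n : ℕ} where

  private
    variable
      t t′ : Fin n
      us vs : List (Fin n)

  split-sorted : ∀ us → AllPairs Fin._<_ (us ++ t ∷ vs) →
                 All (Fin._< t) us × All (t Fin.<_) vs
  split-sorted []       (t<vs ∷ _)  = [] , t<vs
  split-sorted (u ∷ us) (u<  ∷ sorted) with split-sorted us sorted
  ... | us<t , t<vs = All.head (All.++⁻ʳ us u<) ∷ us<t , t<vs

  -- `allFin n` is strictly increasing. The filters behind suffixes and prefixes thus become
  -- segments of it, as `before`, `upto` and `from` record.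
  split-allFin : ∀ us → allFin n ≡ us ++ t ∷ vs →
                 All (Fin._< t) us × All (t Fin.<_) vs
  split-allFin us eq =
    split-sorted us (subst (AllPairs Fin._<_) eq (AllPairs.tabulate⁺-< id))

  before : ∀ us → allFin n ≡ us ++ t ∷ vs → filter (Fin._<? t) (allFin n) ≡ us
  before {t} {vs} us eq with split-allFin us eq
  ... | us<t , t<vs = begin
    filter (Fin._<? t) (allFin n)
      ≡⟨ cong (filter _) eq ⟩
    filter (Fin._<? t) (us ++ t ∷ vs)
      ≡⟨ List.filter-++ (Fin._<? t) us _ ⟩
    filter (Fin._<? t) us ++ filter (Fin._<? t) (t ∷ vs)
      ≡⟨ cong₂ _++_ (List.filter-all (Fin._<? t) us<t)
           (List.filter-none (Fin._<? t) (Fin.<-irrefl refl ∷ All.map Fin.<-asym t<vs)) ⟩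
    us ++ []
      ≡⟨ List.++-identityʳ us ⟩
    us ∎
    where open ≡-Reasoning

  upto : ∀ us → allFin n ≡ us ++ t ∷ vs →
         filter (Fin._≤? t) (allFin n) ≡ us ++ List.[ t ]
  upto {t} {vs} us eq with split-allFin us eq
  ... | us<t , t<vs = begin
    filter (Fin._≤? t) (allFin n)
      ≡⟨ cong (filter _) eq ⟩
    filter (Fin._≤? t) (us ++ t ∷ vs)
      ≡⟨ List.filter-++ (Fin._≤? t) us _ ⟩
    filter (Fin._≤? t) us ++ filter (Fin._≤? t) (t ∷ vs)
      ≡⟨ cong₂ _++_ (List.filter-all (Fin._≤? t) (All.map ℕ.<⇒≤ us<t))
           (trans (List.filter-accept (Fin._≤? t) ℕ.≤-refl)
             (cong (t ∷_) (List.filter-none (Fin._≤? t) (All.map ℕ.<⇒≱ t<vs)))) ⟩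
    us ++ List.[ t ] ∎
    where open ≡-Reasoning

  from : ∀ us → allFin n ≡ us ++ t ∷ vs → filter (t Fin.≤?_) (allFin n) ≡ t ∷ vs
  from {t} {vs} us eq with split-allFin us eq
  ... | us<t , t<vs = begin
    filter (t Fin.≤?_) (allFin n)
      ≡⟨ cong (filter _) eq ⟩
    filter (t Fin.≤?_) (us ++ t ∷ vs)
      ≡⟨ List.filter-++ (t Fin.≤?_) us _ ⟩
    filter (t Fin.≤?_) us ++ filter (t Fin.≤?_) (t ∷ vs)
      ≡⟨ cong₂ _++_ (List.filter-none (t Fin.≤?_) (All.map ℕ.<⇒≱ us<t))
           (List.filter-all (t Fin.≤?_) (ℕ.≤-refl ∷ All.map ℕ.<⇒≤ t<vs)) ⟩
    t ∷ vs ∎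
    where open ≡-Reasoning

  module _ {P : Pred (Fin n) 0ℓ} (P? : Decidable P) where

    count : List (Fin n) → ℕ
    count = length ∘ filter P?

    -- For `t` in `P`, this is the position of `t`, counted from 0, in the chronological list of the
    -- times in `P`.
    index : Fin n → ℕ
    index t = count (filter (Fin._<? t) (allFin n))

    count-++ : ∀ us vs → count (us ++ vs) ≡ count us ℕ.+ count vs
    count-++ us vs = trans (cong length (List.filter-++ P? us vs)) (List.length-++ (filter P? us))

    count-∷ : P t → ∀ us → count (t ∷ us) ≡ suc (count us)
    count-∷ p us = cong length (List.filter-accept P? p)

    count-reverse : ∀ us → count (reverse us) ≡ count us
    count-reverse us = ↭-length (filter-↭ P? (↭-reverse us))

    -- The times before `t′` are those before `t` followed by `us`.
    index-suffix : ∀ {t t′ vs} us → us ++ t′ ∷ vs ≡ filter (t Fin.≤?_) (allFin n) →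
                   index t′ ≡ count us ℕ.+ index t
    index-suffix {t} {t′} {vs} us eq with ∈-∃++ (∈-allFin t)
    ... | us₀ , vs₀ , eq₀ = begin
      index t′                ≡⟨ cong count (before (us₀ ++ us) split) ⟩
      count (us₀ ++ us)       ≡⟨ count-++ us₀ us ⟩
      count us₀ ℕ.+ count us  ≡⟨ ℕ.+-comm (count us₀) _ ⟩
      count us ℕ.+ count us₀  ≡⟨ cong (λ ws → count us ℕ.+ count ws) (before us₀ eq₀) ⟨
      count us ℕ.+ index t    ∎
      where
      open ≡-Reasoning

      split : allFin n ≡ (us₀ ++ us) ++ t′ ∷ vs
      split = begin
        allFin n                 ≡⟨ eq₀ ⟩
        us₀ ++ t ∷ vs₀           ≡⟨ cong (us₀ ++_) (trans eq (from us₀ eq₀)) ⟨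
        us₀ ++ us ++ t′ ∷ vs     ≡⟨ List.++-assoc us₀ us _ ⟨
        (us₀ ++ us) ++ t′ ∷ vs   ∎

    -- Read backwards, a nonempty `us` includes `t` and excludes `t′`, whereas the indices differ by
    -- a count that includes `t′` and excludes `t`. As both times lie in `P`, this makes no
    -- difference. The proof counts the times in `P` up to and including `t` in two ways.
    index-prefix : ∀ {t t′ vs} → P t → P t′ →
      ∀ us → us ++ t′ ∷ vs ≡ reverse (filter (Fin._≤? t) (allFin n)) →
      index t ≡ count us ℕ.+ index t′
    index-prefix {t} {t′} {vs} p p′ us eq with ∈-∃++ (∈-allFin t)
    ... | us₀ , vs₀ , eq₀ = ℕ.suc-injective (begin
      suc (index t)
        ≡⟨ cong (suc ∘ count) (before us₀ eq₀) ⟩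
      suc (count us₀)
        ≡⟨ cong suc (count-reverse us₀) ⟨
      suc (count (reverse us₀))
        ≡⟨ count-∷ p (reverse us₀) ⟨
      count (t ∷ reverse us₀)
        ≡⟨ cong count reversed ⟨
      count (us ++ t′ ∷ vs)
        ≡⟨ trans (count-++ us _) (cong (count us ℕ.+_) (count-∷ p′ vs)) ⟩
      count us ℕ.+ suc (count vs)
        ≡⟨ ℕ.+-suc _ _ ⟩
      suc (count us ℕ.+ count vs)
        ≡⟨ cong (λ m → suc (count us ℕ.+ m)) (count-reverse vs) ⟨
      suc (count us ℕ.+ count (reverse vs))
        ≡⟨ cong (λ ws → suc (count us ℕ.+ count ws)) (before (reverse vs) split) ⟨
      suc (count us ℕ.+ index t′) ∎)
      where
      open ≡-Reasoning

      reversed : us ++ t′ ∷ vs ≡ t ∷ reverse us₀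
      reversed = begin
        us ++ t′ ∷ vs                            ≡⟨ eq ⟩
        reverse (filter (Fin._≤? t) (allFin n))  ≡⟨ cong reverse (upto us₀ eq₀) ⟩
        reverse (us₀ ++ List.[ t ])              ≡⟨ List.reverse-++ us₀ List.[ t ] ⟩
        t ∷ reverse us₀                          ∎

      split : allFin n ≡ reverse vs ++ t′ ∷ (reverse us ++ vs₀)
      split = begin
        allFin n
          ≡⟨ eq₀ ⟩
        us₀ ++ t ∷ vs₀
          ≡⟨ List.++-assoc us₀ List.[ t ] vs₀ ⟨
        (us₀ ++ List.[ t ]) ++ vs₀
          ≡⟨ cong (_++ vs₀) (upto us₀ eq₀) ⟨
        filter (Fin._≤? t) (allFin n) ++ vs₀
          ≡⟨ cong (_++ vs₀) (List.reverse-involutive _) ⟨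
        reverse (reverse (filter (Fin._≤? t) (allFin n))) ++ vs₀
          ≡⟨ cong (λ ws → reverse ws ++ vs₀) eq ⟨
        reverse (us ++ t′ ∷ vs) ++ vs₀
          ≡⟨ cong (_++ vs₀) (trans (List.reverse-++ us (t′ ∷ vs))
               (cong (_++ reverse us) (List.unfold-reverse t′ vs))) ⟩
        ((reverse vs ++ List.[ t′ ]) ++ reverse us) ++ vs₀
          ≡⟨ trans (cong (_++ vs₀) (List.++-assoc (reverse vs) _ _))
               (List.++-assoc (reverse vs) _ vs₀) ⟩
        reverse vs ++ t′ ∷ (reverse us ++ vs₀) ∎

-- Decidability of periodic pacing

module Multiples (𝔽 : ArchimedeanOrderedField) where
  open ArchimedeanOrderedField 𝔽
  open IsCommutativeRing isCommutativeRing using (+-identityˡ)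
  open IsStrictTotalOrder isStrictTotalOrder using (irrefl; _≟_) renaming (trans to <-trans)

  <-multiple-mono : ∀ {x p m n} → 0# < p → m ℕ.≤′ n → x < m · p → x < n · p
  <-multiple-mono 0<p (ℕ.≤′-reflexive refl) x<mp = x<mp
  <-multiple-mono {p = p} 0<p (ℕ.≤′-step {n} m≤n) x<mp =
    <-trans (<-multiple-mono 0<p m≤n x<mp)
      (subst (_< p + n · p) (+-identityˡ (n · p)) (+-monoˡ-< (n · p) 0<p))

  -- The Archimedean property yields `n` with `x < n · p`, and multiples of a positive `p` increase,
  -- so only finitely many candidates remain.
  multiple? : ∀ x p → 0# < p → Dec (∃ λ k → x ≡ k · p)
  multiple? x p 0<p with archimedean p x 0<p
  ... | n , x<np with Fin.any? {n} (λ i → x ≟ toℕ i · p)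
  ... | yes (i , eq) = yes (toℕ i , eq)
  ... | no  ∄i       = no λ (k , eq) → ∄k k eq
    where
    ∄k : ∀ k → x ≡ k · p → ⊥
    ∄k k eq with k ℕ.<? n
    ... | yes k<n =
      ∄i (fromℕ< k<n , trans eq (cong (_· p) (sym (Fin.toℕ-fromℕ< k<n))))
    ... | no  k≮n =
      irrefl eq (<-multiple-mono 0<p (ℕ.≤⇒≤′ (ℕ.≮⇒≥ k≮n)) x<np)

-- What the semantics of expressions depends on

module Proof (𝔽 : ArchimedeanOrderedField) (𝓥 : ValueDomain 𝔽) (Tmax : ℕ)
             (φ : RTLola.Specification 𝔽 𝓥 Tmax) where

  open RTLola 𝔽 𝓥 Tmax
  open ArchimedeanOrderedField 𝔽 hiding (compare)
  open ValueDomain 𝓥 using (⟦_⟧ᵗ)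
  open Specification φ
  open EvaluationModel
  open Semantics

  private
    variable
      ω ω′ : Model φ
      t t′ : Time

  record _~_ (ω ω′ : Model φ) : Set where
    field
      timestamps : ∀ t → timestamp ω t ≡ timestamp ω′ t
      inputs     : ∀ i t → stream ω (inj₁ i) t ≡ stream ω′ (inj₁ i) t

  open _~_

  ~-sym : ω ~ ω′ → ω′ ~ ω
  ~-sym ω~ω′ .timestamps t = sym (timestamps ω~ω′ t)
  ~-sym ω~ω′ .inputs i t   = sym (inputs ω~ω′ i t)

  -- Aggregations are compared by their windows, because the label `Aggr f r` does not tie the
  -- argument type of `f` to the type of `x`.
  Agree : Model φ → Model φ → Kind φ → Stream → Time → Set
  Agree ω ω′ Sync       x t = stream ω x t ≡ stream ω′ x t
  Agree ω ω′ Hold       x t = access ω (hold x) t ≡ access ω′ (hold x) t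
  Agree ω ω′ (Offset o) x t = access ω (offset x o) t ≡ access ω′ (offset x o) t
  Agree ω ω′ (Aggr _ r) x t = window ω x r t ≡ window ω′ x r t

  access-cong : ∀ {τ} (a : Access signature τ) →
                uncurry (Agree ω ω′) (accessTarget φ a) t →
                access ω a t ≡ access ω′ a t
  access-cong (offset x o) agree = agree
  access-cong (hold x)     agree = agree
  access-cong (aggr x f r) agree = cong (ValueDomain.aggregate 𝓥 f) agree

  mutual
    eval-cong : ∀ {τ} (e : Expr signature τ) → timestamp ω t ≡ timestamp ω′ t →
                (∀ {k x} → (k , x) ∈ accesses φ e → Agree ω ω′ k x t) →
                eval ω e t ≡ eval ω′ e t
    eval-cong (const _)  now≡ agree = refl
    eval-cong now        now≡ agree = cong just now≡
    eval-cong (fun f es) now≡ agree = cong (Maybe.map f) (evalAll-cong es now≡ agree)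
    eval-cong (sync x)   now≡ agree = agree (here refl)
    eval-cong {ω = ω} {t = t} {ω′ = ω′} (default a e) now≡ agree
      with access ω a t | access ω′ a t | access-cong {ω = ω} {ω′ = ω′} a (agree (here refl))
    ... | just _  | _ | refl = refl
    ... | nothing | _ | refl = eval-cong e now≡ (agree ∘ there)

    evalAll-cong : ∀ {σs} (es : All (Expr signature) σs) → timestamp ω t ≡ timestamp ω′ t →
                   (∀ {k x} → (k , x) ∈ accessesAll φ es → Agree ω ω′ k x t) →
                   evalAll ω es t ≡ evalAll ω′ es t
    evalAll-cong []       now≡ agree = refl
    evalAll-cong (e ∷ es) now≡ agree =
      cong₂ (Maybe.zipWith _∷_) (eval-cong e now≡ (agree ∘ ∈-++⁺ˡ))
        (evalAll-cong es now≡ (agree ∘ ∈-++⁺ʳ (accesses φ e)))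

  mutual
    -- Only synchronous accesses can leave an expression without a value; all others come with a
    -- default.
    eval-just : ∀ {τ} (e : Expr signature τ) →
                (∀ {x} → (Sync , x) ∈ accesses φ e → Is-just (stream ω x t)) →
                Is-just (eval ω e t)
    eval-just (const _)  available = just tt
    eval-just now        available = just tt
    eval-just {ω = ω} {t = t} (fun f es) available
      with evalAll ω es t | evalAll-just {ω = ω} {t = t} es available
    ... | just _ | _ = just tt
    eval-just (sync x)   available = available (here refl)
    eval-just {ω = ω} {t = t} (default a e) available with access ω a t
    ... | just _  = just tt
    ... | nothing = eval-just e (available ∘ there)

    evalAll-just : ∀ {σs} (es : All (Expr signature) σs) →
                   (∀ {x} → (Sync , x) ∈ accessesAll φ es → Is-just (stream ω x t)) →
                   Is-just (evalAll ω es t)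
    evalAll-just []       available = just tt
    evalAll-just {ω = ω} {t = t} (e ∷ es) available
      with eval ω e t | eval-just {ω = ω} {t = t} e (available ∘ ∈-++⁺ˡ)
         | evalAll ω es t | evalAll-just {ω = ω} {t = t} es (available ∘ ∈-++⁺ʳ (accesses φ e))
    ... | just _ | _ | just _ | _ = just tt

  pacing-cong : ω ~ ω′ → ∀ p → PacingSatisfied ω p t → PacingSatisfied ω′ p t
  pacing-cong {t = t} ω~ω′ (event c)      =
    subst (T ∘ c) (Vec.tabulate-cong λ i → cong is-just (inputs ω~ω′ i t))
  pacing-cong {t = t} ω~ω′ (periodic p _) =
    map₂ (trans (cong value (sym (timestamps ω~ω′ t))))

  pacing? : ∀ (ω : Model φ) p t → Dec (PacingSatisfied ω p t)
  pacing? ω (event c)        t = Bool.T? (c (received ω t))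
  pacing? ω (periodic p 0<p) t = Multiples.multiple? 𝔽 _ _ 0<p

  active? : ∀ ω s t → Dec (Active φ ω s t)
  active? ω s t =
    pacing? ω (pacing s) t ×-dec Maybe.≡-dec Bool._≟_ (eval ω (whenExpr s) t) (just true)

  window-cong : ω ~ ω′ → ∀ x r t →
    (∀ {t′} → t′ Fin.≤ t → stream ω x t′ ≡ stream ω′ x t′) →
    window ω x r t ≡ window ω′ x r t
  window-cong {ω} {ω′} ω~ω′ x r t same = trans
    (mapMaybe-cong-∈ _ λ u∈ →
      same (proj₁ (proj₂ (∈-filter⁻ (inWindow? ω r t) {xs = allFin _} u∈))))
    (cong (mapMaybe (stream ω′ x))
      (List.filter-≐ (inWindow? ω r t) (inWindow? ω′ r t)
        (move ω~ω′ , move (~-sym ω~ω′)) (allFin _)))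
    where
    move : ∀ {ω ω′} → ω ~ ω′ → ∀ {u} → InWindow ω r t u → InWindow ω′ r t u
    move ω~ω′ {u} rewrite timestamps ω~ω′ t | timestamps ω~ω′ u = id

  prefix-cong : ∀ (ω ω′ : Model φ) x t → (∀ {t′} → t′ Fin.≤ t → stream ω x t′ ≡ stream ω′ x t′) →
                prefix ω x t ≡ prefix ω′ x t
  prefix-cong ω ω′ x t same = mapMaybe-cong-∈ _ λ u∈ →
    same (proj₂ (∈-filter⁻ (Fin._≤? t) {xs = allFin _} (reverse⁻ u∈)))

  -- This serves for inputs and for the accesses of when-expressions, where equality of whole
  -- streams is at hand.
  agree-everywhere : ω ~ ω′ → ∀ {x} → (∀ t′ → stream ω x t′ ≡ stream ω′ x t′) →
                     ∀ k t → Agree ω ω′ k x t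
  agree-everywhere {ω} {ω′} ω~ω′ {x} same Sync t = same t
  agree-everywhere {ω} {ω′} ω~ω′ {x} same Hold t = cong head (prefix-cong ω ω′ x t λ _ → same _)
  agree-everywhere {ω} {ω′} ω~ω′ {x} same (Offset +0) t = same t
  agree-everywhere {ω} {ω′} ω~ω′ {x} same (Offset +[1+ n ]) t =
    cong (head ∘ drop (suc n)) (List.mapMaybe-cong same (filter (t Fin.≤?_) (allFin _)))
  agree-everywhere {ω} {ω′} ω~ω′ {x} same (Offset -[1+ n ]) t =
    cong (head ∘ drop (suc n)) (prefix-cong ω ω′ x t λ _ → same _)
  agree-everywhere {ω} {ω′} ω~ω′ {x} same (Aggr _ r) t = window-cong ω~ω′ _ r t λ _ → same _

  -- The times that an access reads

  -- The times t′ at which an access of kind k to a stream that is available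
  -- exactly at the times in P may read it when evaluated at t.  Offsets are
  -- measured by counting the times in P, so that they add up along walks.
  Reads : {P : Pred Time 0ℓ} → Decidable P → Kind φ → Time → Time → Set
  Reads P? Sync       t t′ = t′ ≡ t
  Reads P? Hold       t t′ = t′ Fin.≤ t
  Reads P? (Aggr _ _) t t′ = t′ Fin.≤ t
  Reads P? (Offset o) t t′ =
    + Index.index P? t′ ≡ + Index.index P? t ℤ.+ o × (¬ (0ℤ ℤ.< o) → t′ Fin.≤ t)

  -- `P` will be activity in one reference model, so that a single predicate describes presence in
  -- all the models compared.
  record PresentAt (P : Pred Time 0ℓ) (ω : Model φ) (x : Stream) : Set where
    field
      present : ∀ {t} → P t → Is-just (stream ω x t)
      absent  : ∀ {t} → ¬ P t → stream ω x t ≡ nothing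

  open PresentAt

  -- Once presence is fixed by `P`, so is the time at which an offset access finds its value, and
  -- equality at that time suffices. The premise on `IsSyncOrOffset` is what well-typedness
  -- supplies; negative offsets use it because `index-prefix` asks that `t` lie in `P`.
  agree : ω ~ ω′ → ∀ {x P} (P? : Decidable P) → PresentAt P ω x → PresentAt P ω′ x →
          ∀ {b} k t → (IsSyncOrOffset φ (b , k) → P t) →
          (∀ {t′} → Reads P? k t t′ → stream ω x t′ ≡ stream ω′ x t′) →
          Agree ω ω′ k x t
  agree {ω} {ω′} ω~ω′ {x} P? p p′ Sync t Pt same = same refl
  agree {ω} {ω′} ω~ω′ {x} P? p p′ Hold t Pt same = cong head (prefix-cong ω ω′ x t same)
  agree {ω} {ω′} ω~ω′ {x} P? p p′ (Aggr _ r) t Pt same = window-cong ω~ω′ _ r t same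
  agree {ω} {ω′} ω~ω′ {x} P? p p′ (Offset +0) t Pt same =
    same (sym (ℤ.+-identityʳ _) , λ _ → ℕ.≤-refl)
  agree {ω} {ω′} ω~ω′ {x} P? p p′ (Offset +[1+ n ]) t Pt same =
    head-drop-mapMaybe-cong P? (present p) (absent p) (present p′) (absent p′) (suc n)
      (filter (t Fin.≤?_) (allFin _)) λ us eq _ len → same
        ( cong +_ (trans (Index.index-suffix P? {t} us eq)
            (trans (cong (ℕ._+ Index.index P? t) len) (ℕ.+-comm (suc n) _)))
        , λ o≤0 → ⊥-elim (o≤0 (ℤ.+<+ (s≤s z≤n))))
  agree {ω} {ω′} ω~ω′ {x} P? p p′ (Offset -[1+ n ]) t Pt same =
    head-drop-mapMaybe-cong P? (present p) (absent p) (present p′) (absent p′) (suc n)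
      (reverse (filter (Fin._≤? t) (allFin _))) λ us {u} {vs} eq Pu len → same
        ( back (trans (Index.index-prefix P? (Pt isOffset) Pu us eq) (cong (ℕ._+ _) len))
        , λ _ → proj₂ (∈-filter⁻ (Fin._≤? t) {xs = allFin _}
                   (reverse⁻ (subst (u ∈_) eq (∈-++⁺ʳ us (here refl))))))
    where
    back : ∀ {i j} → i ≡ suc n ℕ.+ j → + j ≡ + i ℤ.+ -[1+ n ]
    back {j = j} refl = sym (begin
      + (suc n ℕ.+ j) ℤ.+ -[1+ n ]    ≡⟨ ℤ.+-comm (+ (suc n ℕ.+ j)) -[1+ n ] ⟩
      -[1+ n ] ℤ.+ (+ suc n ℤ.+ + j)  ≡⟨ ℤ.+-assoc -[1+ n ] (+ suc n) (+ j) ⟨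
      (-[1+ n ] ℤ.+ + suc n) ℤ.+ + j  ≡⟨ cong (ℤ._+ + j) (ℤ.+-inverseˡ (+ suc n)) ⟩
      0ℤ ℤ.+ + j                      ≡⟨ ℤ.+-identityˡ (+ j) ⟩
      + j                             ∎)
      where open ≡-Reasoning

  -- Edges and labels of the dependency graph

  filter-edge : ∀ {s k x} → (k , x) ∈ accesses φ (whenExpr s) → Edge φ (inj₂ s) x
  filter-edge {k = k} k∈ = (Filter , k) , ∈-++⁺ˡ (∈-map⁺ _ k∈)

  eval-edge : ∀ {s k x} → (k , x) ∈ accesses φ (withExpr s) → Edge φ (inj₂ s) x
  eval-edge {s} {k} k∈ =
    (Eval , k) , ∈-++⁺ʳ (List.map _ (accesses φ (whenExpr s))) (∈-map⁺ _ k∈)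

  contains? : ∀ {P : Label φ → Set} → (∀ ℓ → Dec (P ℓ)) →
              ∀ {x y} (w : TransClosure (Edge φ) x y) → Dec (Contains φ P w)
  contains? P? [ ℓ , _ ]     = P? ℓ
  contains? P? ((ℓ , _) ∷ w) = P? ℓ ⊎-dec contains? P? w

  aggrOrHold? : ∀ ℓ → Dec (IsAggrOrHold φ ℓ)
  aggrOrHold? (_ , Sync)     = no λ ()
  aggrOrHold? (_ , Hold)     = yes isHold
  aggrOrHold? (_ , Offset _) = no λ ()
  aggrOrHold? (_ , Aggr _ _) = yes isAggr

  syncOrOffset : ∀ ℓ → ¬ IsAggrOrHold φ ℓ → IsSyncOrOffset φ ℓ
  syncOrOffset (_ , Sync)     _    = isSync
  syncOrOffset (_ , Hold)     ¬aoh = contradiction isHold ¬aoh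
  syncOrOffset (_ , Offset _) _    = isOffset
  syncOrOffset (_ , Aggr _ _) ¬aoh = contradiction isAggr ¬aoh

  kindWeight-0 : ∀ {b} k → ¬ IsOffset φ (b , k) → kindWeight φ k ≡ 0ℤ
  kindWeight-0 Sync       _  = refl
  kindWeight-0 Hold       _  = refl
  kindWeight-0 (Offset _) ¬o = contradiction isOffset ¬o
  kindWeight-0 (Aggr _ _) _  = refl

  weight-0 : ∀ {x y} (w : TransClosure (Edge φ) x y) →
             ¬ Contains φ (IsOffset φ) w → weight φ w ≡ 0ℤ
  weight-0 [ (_ , k) , _ ]     ¬o = kindWeight-0 k ¬o
  weight-0 (((_ , k) , _) ∷ w) ¬o =
    cong₂ ℤ._+_ (kindWeight-0 k (¬o ∘ inj₁)) (weight-0 w (¬o ∘ inj₂))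

  -- Walks that start with a `Filter` edge

  infix 4 _⊐_

  -- Since the walk may continue along arbitrary edges, the streams `y` with `s ⊐ y` are closed
  -- under further accesses.
  _⊐_ : ID↓ → ID↓ → Set
  s ⊐ y = ∃ λ (ℓ : Kind φ × Stream) →
    ℓ ∈ accesses φ (whenExpr s) × Star (Edge φ) (proj₂ ℓ) (inj₂ y)

  module _ (wf : WellFormed φ) where
    open WellFormed wf

    ⊐-irrefl : ∀ {s} → ¬ s ⊐ s
    ⊐-irrefl ((k , x) , k∈ , path) = noZeroCycle cycle
      (weight-0 cycle λ offset → noFilterOffsetCycle cycle
        (contains (filter-edge k∈) path isFilter , offset))
      where
      _◅⁺_ : ∀ {x y z} → Edge φ x y → Star (Edge φ) y z → TransClosure (Edge φ) x z
      e ◅⁺ ε        = [ e ]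
      e ◅⁺ (e′ ◅ p) = e ∷ (e′ ◅⁺ p)

      contains : ∀ {x y z} (e : Edge φ x y) (p : Star (Edge φ) y z) →
                 IsFilter φ (proj₁ e) → Contains φ (IsFilter φ) (_◅⁺_ {x} e p)
      contains e ε       = id
      contains e (_ ◅ _) = inj₁

      cycle : Cycle φ _
      cycle = filter-edge k∈ ◅⁺ path

    ⊐-trans : ∀ {s y z} → s ⊐ y → y ⊐ z → s ⊐ z
    ⊐-trans (ℓ , ℓ∈ , p) (_ , m∈ , q) = ℓ , ℓ∈ , p ◅◅ (filter-edge m∈ ◅ q)

    ⊐-acyclic : ∀ {s} → ¬ TransClosure _⊐_ s s
    ⊐-acyclic = ⊐-irrefl ∘ Closure.transitive⁻ _⊐_ ⊐-trans

  -- Acyclicity of the dependencies between stream-time pairs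

  Node : Set
  Node = ID↓ × Time

  module Dependencies (wt : WellTyped φ) (wf : WellFormed φ)
                      (ω : Model φ) (increasing : IncreasingTime φ ω) where
    open WellFormed wf

    -- When-expressions enter only through activity in the fixed model `ω`, so the accesses
    -- considered are those of with-expressions.
    DependsOn : Node → Node → Set
    DependsOn (s , t) (x , t′) = ∃ λ k →
      (k , inj₂ x) ∈ accesses φ (withExpr s) × Active φ ω s t × Reads (active? ω x) k t t′

    walk : ∀ {p q} → TransClosure DependsOn p q →
           TransClosure (Edge φ) (inj₂ (proj₁ p)) (inj₂ (proj₁ q))
    walk [ k , k∈ , _ ]     = [ eval-edge k∈ ]
    walk ((k , k∈ , _) ∷ w) = eval-edge k∈ ∷ walk w

    past-edge : ∀ {s t x t′} ((k , _) : DependsOn (s , t) (x , t′)) →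
                ¬ IsFutureOffset φ (Eval , k) →
                t′ Fin.≤ t × (t′ ≡ t → kindWeight φ k ≡ 0ℤ)
    past-edge (Sync     , _ , _ , refl)       _   = ℕ.≤-refl , λ _ → refl
    past-edge (Hold     , _ , _ , t′≤t)       _   = t′≤t , λ _ → refl
    past-edge (Aggr _ _ , _ , _ , t′≤t)       _   = t′≤t , λ _ → refl
    past-edge (Offset o , _ , _ , eq , t′≤t) ¬fut =
      t′≤t (¬fut ∘ isFutureOffset) ,
      λ { refl → identityʳ-unique _ _ (sym eq) }

    -- No edge increases time. If the walk returns to its initial time, every intermediate time is
    -- squeezed to the same value, and an offset that leaves both time and index unchanged is 0.
    past : ∀ {s t x t′} (w : TransClosure DependsOn (s , t) (x , t′)) →
           ¬ Contains φ (IsFutureOffset φ) (walk w) →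
           t′ Fin.≤ t × (t′ ≡ t → weight φ (walk w) ≡ 0ℤ)
    past [ d ]   ¬fut = past-edge d ¬fut
    past (d ∷ w) ¬fut with past-edge d (¬fut ∘ inj₁) | past w (¬fut ∘ inj₂)
    ... | t₁≤t , eq₁ | t′≤t₁ , eq₂ = Fin.≤-trans t′≤t₁ t₁≤t , λ { refl →
      let t₁≡t = Fin.≤-antisym t₁≤t t′≤t₁ in
      cong₂ ℤ._+_ (eq₁ t₁≡t) (eq₂ (sym t₁≡t)) }

    index : ID↓ → Time → ℤ
    index s t = + Index.index (active? ω s) t

    ActiveWithin : ID↓ → ID↓ → Set
    ActiveWithin s x = ∀ {u} → Active φ ω s u → Active φ ω x u

    index-cong : ∀ {s x} → ActiveWithin s x → ActiveWithin x s → ∀ t → index s t ≡ index x t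
    index-cong {s} {x} s⊆x x⊆s t =
      cong (+_ ∘ length) (List.filter-≐ (active? ω s) (active? ω x) (s⊆x , x⊆s)
        (filter (Fin._<? t) (allFin _)))

    within-edge : ∀ {s t x t′} ((k , _) : DependsOn (s , t) (x , t′)) →
                  ¬ IsAggrOrHold φ (Eval , k) → ActiveWithin s x
    within-edge (k , k∈ , _) ¬async =
      wt (eval-edge k∈) (syncOrOffset (Eval , k) ¬async) ω increasing _

    within : ∀ {s t x t′} (w : TransClosure DependsOn (s , t) (x , t′)) →
             ¬ Contains φ (IsAggrOrHold φ) (walk w) → ActiveWithin s x
    within [ d ]   ¬async = within-edge d ¬async
    within (d ∷ w) ¬async = within w (¬async ∘ inj₂) ∘ within-edge d (¬async ∘ inj₁)

    index-edge : ∀ {s t x t′} ((k , _) : DependsOn (s , t) (x , t′)) →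
                 ¬ IsAggrOrHold φ (Eval , k) →
                 index x t′ ≡ index x t ℤ.+ kindWeight φ k
    index-edge (Sync     , _ , _ , refl)   _ = sym (ℤ.+-identityʳ _)
    index-edge (Offset o , _ , _ , eq , _) _ = eq
    index-edge (Hold     , _) ¬async = contradiction isHold ¬async
    index-edge (Aggr _ _ , _) ¬async = contradiction isAggr ¬async

    -- Well-typedness gives only inclusions of activity sets along the edges. The inclusion of `x`
    -- in `s` closes them up, so all these sets are equal, indices may be taken in any of them, and
    -- the offsets telescope.
    index-walk : ∀ {s t x t′} (w : TransClosure DependsOn (s , t) (x , t′)) →
                 ¬ Contains φ (IsAggrOrHold φ) (walk w) → ActiveWithin x s →
                 index x t′ ≡ index s t ℤ.+ weight φ (walk w)
    index-walk {t = t} [ d@(k , _) ] ¬async x⊆s =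
      trans (index-edge d ¬async)
        (cong (ℤ._+ kindWeight φ k) (index-cong x⊆s (within-edge d ¬async) t))
    index-walk {s} {t} {x} {t′} (_∷_ {y = s₁ , t₁} d@(k , _) w) ¬async x⊆s = begin
      index x t′
        ≡⟨ index-walk w ¬async₂ (s⊆s₁ ∘ x⊆s) ⟩
      index s₁ t₁ ℤ.+ weight φ (walk w)
        ≡⟨ cong (ℤ._+ weight φ (walk w)) (index-edge d ¬async₁) ⟩
      index s₁ t ℤ.+ kindWeight φ k ℤ.+ weight φ (walk w)
        ≡⟨ ℤ.+-assoc (index s₁ t) (kindWeight φ k) (weight φ (walk w)) ⟩
      index s₁ t ℤ.+ (kindWeight φ k ℤ.+ weight φ (walk w))
        ≡⟨ cong (ℤ._+ (kindWeight φ k ℤ.+ weight φ (walk w)))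
             (index-cong (x⊆s ∘ within w ¬async₂) s⊆s₁ t) ⟩
      index s t ℤ.+ (kindWeight φ k ℤ.+ weight φ (walk w)) ∎
      where
      open ≡-Reasoning
      ¬async₁ = ¬async ∘ inj₁
      ¬async₂ = ¬async ∘ inj₂
      s⊆s₁ = within-edge d ¬async₁

    acyclic : ∀ {p} → ¬ TransClosure DependsOn p p
    acyclic w with contains? aggrOrHold? (walk w)
    ... | yes async = noZeroCycle (walk w)
      (proj₂ (past w λ future → noFutureAsyncCycle (walk w) (future , async)) refl)
    ... | no ¬async = noZeroCycle (walk w)
      (identityʳ-unique _ _ (sym (index-walk w ¬async id)))

  -- Stream equations as a function

  out : Model φ → (s : ID↓) → Time → Maybe ⟦ typeOf (inj₂ s) ⟧ᵗ
  out ω s t with active? ω s t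
  ... | yes _ = eval ω (withExpr s) t
  ... | no  _ = nothing

  out-active : ∀ ω {s t} → Active φ ω s t → out ω s t ≡ eval ω (withExpr s) t
  out-active ω {s} {t} active with active? ω s t
  ... | yes _      = refl
  ... | no ¬active = contradiction active ¬active

  out-inactive : ∀ ω {s t} → ¬ Active φ ω s t → out ω s t ≡ nothing
  out-inactive ω {s} {t} ¬active with active? ω s t
  ... | yes active = contradiction active ¬active
  ... | no _       = refl

  ⇓⇒out : ∀ {ω s t v} → _⇓[_,_]_ φ s ω t v → v ≡ out ω s t
  ⇓⇒out {ω} (emit active eq) = sym (trans (out-active ω active) eq)
  ⇓⇒out {ω} (skip ¬active)   = sym (out-inactive ω ¬active)

  -- `out` is `nothing` also when the with-expression of an active stream has no value, while
  -- `_⇓[_,_]_` then relates the stream to no value at all. The premise on `v` excludes this case.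
  out⇒⇓ : ∀ {ω s t v} → v ≡ out ω s t → (Active φ ω s t → Is-just v) → _⇓[_,_]_ φ s ω t v
  out⇒⇓ {ω} {s} {t} v≡out present with active? ω s t
  ... | no ¬active rewrite v≡out = skip ¬active
  ... | yes active with just _ ← present active = emit active (sym v≡out)

  -- Iterated stream equations

  module Iteration (wt : WellTyped φ) (wf : WellFormed φ)
                   (I : Time → (i : ID↑) → Maybe ⟦ typeOf (inj₁ i) ⟧ᵗ)
                   (τ : Time → ℝ⁺)
                   (τ-increasing : ∀ {t t′} → t Fin.< t′ → value (τ t) < value (τ t′)) where

    record Extends (ω : Model φ) : Set where
      field
        timestamp-τ : ∀ t → timestamp ω t ≡ τ t
        input-I     : ∀ i t → stream ω (inj₁ i) t ≡ I t i

    open Extends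

    extends-~ : Extends ω → Extends ω′ → ω ~ ω′
    extends-~ e e′ .timestamps t = trans (timestamp-τ e t) (sym (timestamp-τ e′ t))
    extends-~ e e′ .inputs i t   = trans (input-I e i t) (sym (input-I e′ i t))

    extends-increasing : Extends ω → IncreasingTime φ ω
    extends-increasing e t rewrite timestamp-τ e (inject₁ t) | timestamp-τ e (suc t) =
      τ-increasing (ℕ.≤-reflexive (cong suc (Fin.toℕ-inject₁ t)))

    -- Reached n consists of the results of applying the stream equations n
    -- times to some model.  Every solution is in all of these sets, which
    -- decrease with n, so the theorem follows once they are singletons.
    data Reached : ℕ → Model φ → Set where
      start : Extends ω → Reached zero ω
      next  : ∀ {n} → Extends ω → Reached n ω′ →
              (∀ s t → stream ω (inj₂ s) t ≡ out ω′ s t) → Reached (suc n) ω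

    private
      variable
        n : ℕ

    reached-extends : Reached n ω → Extends ω
    reached-extends (start e)    = e
    reached-extends (next e _ _) = e

    -- The first application of the equations is forgotten, and its result becomes the starting
    -- model.
    reached-pred : Reached (suc n) ω → Reached n ω
    reached-pred (next e (start _) _)        = start e
    reached-pred (next e r@(next _ _ _) eq) = next e (reached-pred r) eq

    reached-+ : ∀ m → Reached (m ℕ.+ n) ω → Reached n ω
    reached-+ zero    = id
    reached-+ (suc m) = reached-+ m ∘ reached-pred

    -- One more than the number of nodes, which bounds the length of dependency chains.
    depth : ℕ
    depth = suc (#outputs ℕ.* suc Tmax)

    -- `H` is a class of streams, closed under the accesses of with-expressions, whose activity no
    -- longer varies from round `N` on; `ω₀` serves as the reference for it. The module is used for
    -- the streams behind a when-expression and finally for all streams.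
    module Settled {N} (ω₀ : Model φ) (r₀ : Reached N ω₀) {H : ID↓ → Set}
      (closed : ∀ {s k x} → H s → (k , inj₂ x) ∈ accesses φ (withExpr s) → H x)
      (settled : ∀ {s} → H s → ∀ {ω ω′} → Reached N ω → Reached N ω′ →
                 ∀ {t} → Active φ ω s t → Active φ ω′ s t)
      where

      increasing₀ : IncreasingTime φ ω₀
      increasing₀ = extends-increasing (reached-extends r₀)

      open Dependencies wt wf ω₀ increasing₀ using (DependsOn; acyclic)

      node-induction : (P : ℕ → Node → Set) →
        (∀ k {p} → (∀ {q} → DependsOn p q → P k q) → P (suc k) p) → ∀ p → P depth p
      node-induction = acyclic-induction {ι = uncurry combine} injective acyclic
        where
        injective : ∀ {p q : Node} → uncurry combine p ≡ uncurry combine q → p ≡ q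
        injective {s , t} {x , u} eq with Fin.combine-injective s t x u eq
        ... | refl , refl = refl

      -- In early iterates a synchronous access may fail even in an active stream. By well-typedness
      -- the accessed stream is active too, and by induction along dependencies it has a value one
      -- round earlier.
      reached-present : ∀ {s t} → H s → Active φ ω₀ s t →
                        Reached (depth ℕ.+ N) ω → Is-just (stream ω (inj₂ s) t)
      reached-present {s = s} {t} h active r = node-induction Present step (s , t) h active r
        where
        Present : ℕ → Node → Set
        Present k (s , t) = H s → Active φ ω₀ s t →
          ∀ {ω} → Reached (k ℕ.+ N) ω → Is-just (stream ω (inj₂ s) t)

        step : ∀ k {p} → (∀ {q} → DependsOn p q → Present k q) → Present (suc k) p
        step k {s , t} ih h active (next {ω′ = ω′} _ r′ eq) =
          subst Is-just (sym (trans (eq s t) (out-active ω′ active′)))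
            (eval-just (withExpr s) λ
              { {inj₁ i} x∈ → wt (eval-edge x∈) isSync ω′ increasing′ t active′
              ; {inj₂ x} x∈ → ih (Sync , x∈ , active , refl) (closed h x∈)
                  (wt (eval-edge x∈) isSync ω₀ increasing₀ t active) r′ })
          where
          active′ = settled h r₀ (reached-+ k r′) active
          increasing′ = extends-increasing (reached-extends r′)

      reached-absent : ∀ m {s t} → H s → ¬ Active φ ω₀ s t →
                       Reached (suc m ℕ.+ N) ω → stream ω (inj₂ s) t ≡ nothing
      reached-absent m {s} {t} h ¬active (next {ω′ = ω′} _ r′ eq) =
        trans (eq s t) (out-inactive ω′ (¬active ∘ settled h (reached-+ m r′) r₀))

      presentAt : ∀ {x} → H x → Reached (depth ℕ.+ N) ω → PresentAt (Active φ ω₀ x) ω (inj₂ x)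
      presentAt h r .present active = reached-present h active r
      presentAt h r .absent ¬active = reached-absent _ h ¬active r

      -- The first `depth` rounds make presence coincide with activity in `ω₀`, as `agree` requires.
      -- The other `depth` rounds propagate equality of values along the dependencies.
      reached-unique : ∀ {s} → H s → ∀ {ω ω′} →
        Reached (depth ℕ.+ (depth ℕ.+ N)) ω → Reached (depth ℕ.+ (depth ℕ.+ N)) ω′ →
        ∀ t → stream ω (inj₂ s) t ≡ stream ω′ (inj₂ s) t
      reached-unique {s} h r r′ t = node-induction Unique step (s , t) h r r′
        where
        Unique : ℕ → Node → Set
        Unique k (s , t) = H s → ∀ {ω ω′} →
          Reached (k ℕ.+ (depth ℕ.+ N)) ω → Reached (k ℕ.+ (depth ℕ.+ N)) ω′ →
          stream ω (inj₂ s) t ≡ stream ω′ (inj₂ s) t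

        step : ∀ k {p} → (∀ {q} → DependsOn p q → Unique k q) → Unique (suc k) p
        step k {s , t} ih h (next {ω′ = ω} _ r eq) (next {ω′ = ω′} _ r′ eq′) =
          trans (eq s t) (trans same (sym (eq′ s t)))
          where
          low : ∀ {ω} → Reached (k ℕ.+ (depth ℕ.+ N)) ω → Reached N ω
          low = reached-+ depth ∘ reached-+ k

          ω~ω′ : ω ~ ω′
          ω~ω′ = extends-~ (reached-extends r) (reached-extends r′)

          agree-access : Active φ ω₀ s t → ∀ {k x} → (k , x) ∈ accesses φ (withExpr s) →
                         Agree ω ω′ k x t
          agree-access active {k} {inj₁ i} k∈ = agree-everywhere ω~ω′ (inputs ω~ω′ i) k t
          agree-access active {k} {inj₂ x} k∈ =
            agree ω~ω′ (active? ω₀ x)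
              (presentAt (closed h k∈) (reached-+ _ r)) (presentAt (closed h k∈) (reached-+ _ r′))
              k t (λ so → wt (eval-edge k∈) so ω₀ increasing₀ t active)
              (λ reads → ih (k , k∈ , active , reads) (closed h k∈) r r′)

          same : out ω s t ≡ out ω′ s t
          same with active? ω₀ s t
          ... | yes active = trans (out-active ω (settled h r₀ (low r) active))
                (trans (eval-cong (withExpr s) (timestamps ω~ω′ t) (agree-access active))
                  (sym (out-active ω′ (settled h r₀ (low r′) active))))
          ... | no ¬active = trans (out-inactive ω (¬active ∘ settled h (low r) r₀))
                (sym (out-inactive ω′ (¬active ∘ settled h (low r′) r₀)))

    -- Settling of activity

    rounds : ℕ → ℕ
    rounds zero    = zero
    rounds (suc k) = depth ℕ.+ (depth ℕ.+ rounds k)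

    ActivitySettled : ℕ → ID↓ → Set
    ActivitySettled k s = ∀ {ω ω′} → Reached (rounds k) ω → Reached (rounds k) ω′ →
      ∀ {t} → Active φ ω s t → Active φ ω′ s t

    -- By induction, `Settled` applies to the class of all `y` with `s ⊐ y`. It makes the streams
    -- accessed by the when-expression of `s` equal, and with inputs and timestamps these determine
    -- the activity of `s`.
    activity-settles : ∀ s → ActivitySettled (suc #outputs) s
    activity-settles = acyclic-induction {ι = id} id (⊐-acyclic wf) ActivitySettled step
      where
      step : ∀ k {s} → (∀ {y} → s ⊐ y → ActivitySettled k y) → ActivitySettled (suc k) s
      step k {s} ih {ω} {ω′} r r′ {t} (paced , when) =
        pacing-cong ω~ω′ (pacing s) paced ,
        trans (sym (eval-cong (whenExpr s) (timestamps ω~ω′ t) λ {k} {x} k∈ →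
          agree-everywhere ω~ω′ (same k∈) k t)) when
        where
        ω~ω′ : ω ~ ω′
        ω~ω′ = extends-~ (reached-extends r) (reached-extends r′)
        closed : ∀ {y k x} → s ⊐ y → (k , inj₂ x) ∈ accesses φ (withExpr y) → s ⊐ x
        closed (ℓ , ℓ∈ , path) k∈ = ℓ , ℓ∈ , path ◅◅ (eval-edge k∈ ◅ ε)

        settled : ∀ {y} → s ⊐ y → ActivitySettled k y
        settled s⊐y {ω} {ω′} = ih s⊐y {ω} {ω′}

        open Settled ω (reached-+ depth (reached-+ depth r)) closed settled
          using (reached-unique)

        same : ∀ {k x} → (k , x) ∈ accesses φ (whenExpr s) → ∀ t → stream ω x t ≡ stream ω′ x t
        same {x = inj₁ i} _  = inputs ω~ω′ i
        -- The empty walk `ε` shows that a directly accessed `y` satisfies `s ⊐ y`.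
        same {x = inj₂ y} k∈ = reached-unique (_ , k∈ , ε) r r′

    -- Existence and uniqueness of the solution

    iterate : ℕ → Model φ
    iterate n .timestamp = τ
    iterate n .stream (inj₁ i) t = I t i
    iterate zero    .stream (inj₂ s) t = nothing
    iterate (suc n) .stream (inj₂ s) t = out (iterate n) s t

    iterate-extends : ∀ n → Extends (iterate n)
    iterate-extends n .timestamp-τ t = refl
    iterate-extends n .input-I i t   = refl

    iterate-reached : ∀ n → Reached n (iterate n)
    iterate-reached zero    = start (iterate-extends zero)
    iterate-reached (suc n) = next (iterate-extends (suc n)) (iterate-reached n) λ _ _ → refl

    solution-reached : ⟦_⟧∋_ φ ω → Extends ω → ∀ n → Reached n ω
    solution-reached sol e zero    = start e
    solution-reached sol e (suc n) =
      next e (solution-reached sol e n) λ s t → ⇓⇒out (⟦_⟧∋_.equations sol s t)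

    settling final : ℕ
    settling = rounds (suc #outputs)
    final    = depth ℕ.+ (depth ℕ.+ settling)

    solution : Model φ
    solution = iterate final

    solution-settled : Reached settling solution
    solution-settled = reached-+ depth (reached-+ depth (iterate-reached final))

    settled-everywhere : ∀ {s} → ⊤ → ActivitySettled (suc #outputs) s
    settled-everywhere {s} _ = activity-settles s

    open Settled solution solution-settled (λ _ _ → tt) settled-everywhere
      using (reached-present; reached-unique)

    -- The iterate after `solution` is in `Reached final` as well, so uniqueness identifies the two.
    solution-fixed : ∀ s t → stream solution (inj₂ s) t ≡ out solution s t
    solution-fixed s t =
      reached-unique tt (iterate-reached final) (reached-pred (iterate-reached (suc final))) t

    solution-solves : ⟦_⟧∋_ φ solution
    solution-solves .⟦_⟧∋_.increasing = extends-increasing (iterate-extends final)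
    solution-solves .⟦_⟧∋_.equations s t = out⇒⇓ (solution-fixed s t) λ active →
      reached-present tt active (reached-+ depth (iterate-reached final))

    solution-unique : ⟦_⟧∋_ φ ω → Extends ω → _≈ᵐ_ φ solution ω
    solution-unique sol e ._≈ᵐ_.stream-≡ (inj₁ i) t = sym (input-I e i t)
    solution-unique sol e ._≈ᵐ_.stream-≡ (inj₂ s) t =
      reached-unique tt (iterate-reached final) (solution-reached sol e final) t
    solution-unique sol e ._≈ᵐ_.timestamp-≡ t = sym (timestamp-τ e t)

theorem1 : (𝔽 : ArchimedeanOrderedField) (𝓥 : ValueDomain 𝔽) (Tmax : ℕ) →
    let open RTLola 𝔽 𝓥 Tmax in
    (φ : Specification) → WellTyped φ → WellFormed φ → WellDefined φ
theorem1 𝔽 𝓥 Tmax φ wt wf I τ inc =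
  solution , (solution-solves , λ t → refl , λ _ → refl) ,
  λ (sol , e) → solution-unique sol record
    { timestamp-τ = proj₁ ∘ e ; input-I = λ i t → proj₂ (e t) i }
  where open Proof.Iteration 𝔽 𝓥 Tmax φ wt wf I τ inc
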